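{- Let $I$ be a countable set with $|I|\ge 2$, let $\mathfrak{M}_i=(S_i,\mathcal{L}_i)$ be partial linear spaces for $i\in I$, let $\mathfrak{M}=\bigotimes_{i\in I}\mathfrak{M}_i$ with point set $S=\prod_{i\in I}S_i$, and for each $i$ let $\mathcal{H}_i^{\mathrm{all}}$ denote the family consisting of all hyperplanes of $\mathfrak{M}_i$ together with the set $S_i$. For $\mathcal{H}\subseteq S$ the following are equivalent: (1) $\mathcal{H}$ is a hyperplane of $\mathfrak{M}$; (2) for all $a\in S$ and $i\in I$ we have $\mathcal{H}^{[a]}_i\in\mathcal{H}_i^{\mathrm{all}}$, and there exist $a\in S$, $i\in I$ with $\mathcal{H}^{[a]}_i\neq S_i$.
   Context: A partial linear space is a pair $(S,\mathcal{L})$ with $\mathcal{L}$ a family of subsets of $S$ (lines) such that every line has at least two points, every point lies on a line, and two distinct lines share at most one point. A subspace is a set $X$ such that any line meeting $X$ in at least two points is contained in $X$; a hyperplane is a proper subspace meeting every line. Segre product: for $a\in S=\prod_{i\in I}S_i$, $i\in I$ and $x\in S_i$, $a[i/x]$ denotes $a$ with its $i$-th coordinate replaced by $x$, and for $A\subseteq S_i$, $a[i/A]=\{a[i/x]:x\in A\}$. The Segre product $\bigotimes_{i\in I}\mathfrak{M}_i$ has point set $S$ and lines $a[i/l]$ for $a\in S$, $i\in I$, $l\in\mathcal{L}_i$. For $\mathcal{H}\subseteq S$, $a\in S$, $i\in I$: $\mathcal{H}^{[a]}_i=\{x\in S_i: a[i/x]\in\mathcal{H}\}$. -}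

module Defs where

open import Level using (Level; suc)
open import Data.Nat.Base using (ℕ)
import Data.Nat.Properties as ℕ
open import Data.Product.Base using (∃; ∃₂; _×_)
open import Data.Sum.Base using (_⊎_)
open import Function.Bundles using (_↣_)
open import Relation.Binary.Definitions using (DecidableEquality)
open import Relation.Binary.PropositionalEquality.Core using (_≡_; _≢_; subst)
open import Relation.Nullary.Decidable using (via-injection; yes; no)
open import Relation.Nullary.Negation.Core using (¬_)
open import Relation.Unary using (Pred; _∈_; _⊆_; _≐_; _≬_; _∩_; U)

HasTwoPoints : {ℓ : Level} {A : Set ℓ} → Pred A ℓ → Set ℓ
HasTwoPoints P = ∃₂ λ x y → x ≢ y × x ∈ P × y ∈ P

-- Subsets are predicates, and two subsets are equal when they have the same
-- elements (_≐_).  The level of Line is suc ℓ because the lines of a Segre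
-- product are given by an existential quantifier over subsets.
record PointLineSpace (ℓ : Level) : Set (suc (suc ℓ)) where
  field
    Point : Set ℓ
    Line  : Pred (Pred Point ℓ) (suc ℓ)

open PointLineSpace public

record IsPartialLinear {ℓ : Level} (𝔐 : PointLineSpace ℓ) : Set (suc ℓ) where
  field
    line-hasTwoPoints : ∀ {L} → L ∈ Line 𝔐 → HasTwoPoints L
    point-onLine      : ∀ x → ∃ λ L → L ∈ Line 𝔐 × x ∈ L
    lines-shareAtMostOne : ∀ {L M} → L ∈ Line 𝔐 → M ∈ Line 𝔐 → ¬ (L ≐ M) →
                           ∀ {x y} → x ∈ L ∩ M → y ∈ L ∩ M → x ≡ y

record PartialLinearSpace (ℓ : Level) : Set (suc (suc ℓ)) where
  field
    space           : PointLineSpace ℓ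
    isPartialLinear : IsPartialLinear space

open PartialLinearSpace public

module _ {ℓ : Level} (𝔐 : PointLineSpace ℓ) where

  IsSubspace : Pred (Point 𝔐) ℓ → Set (suc ℓ)
  IsSubspace X = ∀ {L} → L ∈ Line 𝔐 → HasTwoPoints (L ∩ X) → L ⊆ X

  record IsHyperplane (X : Pred (Point 𝔐) ℓ) : Set (suc ℓ) where
    field
      isSubspace     : IsSubspace X
      proper         : ¬ (X ≐ U)
      meetsEveryLine : ∀ {L} → L ∈ Line 𝔐 → L ≬ X

  ℋᵃˡˡ : Pred (Pred (Point 𝔐) ℓ) (suc ℓ)
  ℋᵃˡˡ X = IsHyperplane X ⊎ X ≐ U

-- Countable means finite or countably infinite.  An injection into ℕ makes
-- equality of indices decidable, as needed to replace a single coordinate.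
Countable : {ℓ : Level} → Set ℓ → Set ℓ
Countable I = I ↣ ℕ

countable⇒≟ : {ℓ : Level} {I : Set ℓ} → Countable I → DecidableEquality I
countable⇒≟ f = via-injection f ℕ._≟_

module Coordinates {ℓ : Level} {I : Set ℓ} (_≟_ : DecidableEquality I) (S : I → Set ℓ) where

  infix 8 _[_/_] _[_/_]ˢ

  _[_/_] : (∀ j → S j) → (i : I) → S i → ∀ j → S j
  (a [ i / x ]) j with i ≟ j
  ... | yes i≡j = subst S i≡j x
  ... | no  _   = a j

  _[_/_]ˢ : (∀ j → S j) → (i : I) → Pred (S i) ℓ → Pred (∀ j → S j) ℓ
  (a [ i / A ]ˢ) b = ∃ λ x → x ∈ A × b ≡ a [ i / x ]

  -- section ℋ a i is the set written ℋ with superscript [a] and subscript i.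
  section : Pred (∀ j → S j) ℓ → (∀ j → S j) → (i : I) → Pred (S i) ℓ
  section ℋ a i x = a [ i / x ] ∈ ℋ

module _ {ℓ : Level} {I : Set ℓ} (_≟_ : DecidableEquality I) (𝔐 : I → PointLineSpace ℓ) where

  open Coordinates _≟_ (λ i → Point (𝔐 i))

  ⨂ : PointLineSpace ℓ
  ⨂ = record
    { Point = ∀ i → Point (𝔐 i)
    ; Line  = λ L → ∃₂ λ a i → ∃ λ l → l ∈ Line (𝔐 i) × L ≐ a [ i / l ]ˢ
    }

{-# OPTIONS --safe #-}
module Submission where

open import Defs
open import Axiom.ExcludedMiddle using (ExcludedMiddle)
open import Axiom.Extensionality.Propositional using (Extensionality)
open import Data.Product.Base using (∃₂; _×_; _,_)
open import Data.Sum.Base using (inj₁; inj₂)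
open import Data.Unit.Base using (tt)
open import Function.Base using (id)
open import Function.Bundles using (_⇔_; mk⇔)
open import Level using (Level)
open import Relation.Binary.Definitions using (DecidableEquality)
open import Relation.Binary.PropositionalEquality.Core
  using (_≡_; _≢_; refl; sym; trans; cong; subst)
open import Relation.Nullary.Decidable using (yes; no; decidable-stable)
open import Relation.Nullary.Negation.Core using (¬_; contradiction)
open import Relation.Unary using (Pred; _∈_; _≐_; _≬_; U)

-- Every line of the Segre product varies in a single coordinate, and `x ↦ a [ i / x ]` is an
-- injection carrying the lines of `𝔐 i` to lines of the product. So being a subspace and meeting
-- every line are conditions checked line by line: `ℋ` has either property exactly when all its
-- sections do. Properness is not inherited in this way, since a section of a hyperplane may be the
-- whole factor; hence `ℋᵃˡˡ`. It survives for at least one section: a point `b` outside `ℋ` equals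
-- `b [ i / b i ]`, so the section through `b` misses `b i`.

module _ {ℓ : Level} {I : Set ℓ} (_≟_ : DecidableEquality I) (S : I → Set ℓ) where

  open Coordinates _≟_ S

  [/]-updates : ∀ a i (x : S i) → (a [ i / x ]) i ≡ x
  [/]-updates a i x with i ≟ i
  ... | yes refl = refl
  ... | no  i≢i  = contradiction refl i≢i

  [/]-injective : ∀ a i {x y : S i} → a [ i / x ] ≡ a [ i / y ] → x ≡ y
  [/]-injective a i {x} {y} eq =
    trans (sym ([/]-updates a i x)) (trans (cong (λ b → b i) eq) ([/]-updates a i y))

  -- Coordinatewise, because equality of dependent functions requires extensionality, which is
  -- applied only where a point is identified with a member of its own fibre.
  [/]-id : ∀ a i j → (a [ i / a i ]) j ≡ a j
  [/]-id a i j with i ≟ j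
  ... | yes refl = refl
  ... | no  _    = refl

module _ {ℓ : Level} {𝔐 : PointLineSpace ℓ} {X : Pred (Point 𝔐) ℓ} where

  ℋᵃˡˡ⇒isSubspace : X ∈ ℋᵃˡˡ 𝔐 → IsSubspace 𝔐 X
  ℋᵃˡˡ⇒isSubspace (inj₁ hyp)       = IsHyperplane.isSubspace hyp
  ℋᵃˡˡ⇒isSubspace (inj₂ (_ , U⊆X)) = λ _ _ _ → U⊆X tt

  -- In the case of the full set, the common point exists because lines of a partial linear space
  -- are nonempty.
  ℋᵃˡˡ⇒meetsEveryLine : IsPartialLinear 𝔐 → X ∈ ℋᵃˡˡ 𝔐 → ∀ {L} → L ∈ Line 𝔐 → L ≬ X
  ℋᵃˡˡ⇒meetsEveryLine pl (inj₁ hyp)       L∈ = IsHyperplane.meetsEveryLine hyp L∈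
  ℋᵃˡˡ⇒meetsEveryLine pl (inj₂ (_ , U⊆X)) L∈
    with x , _ , _ , x∈L , _ ← IsPartialLinear.line-hasTwoPoints pl L∈ = x , x∈L , U⊆X tt

module _ {ℓ : Level} {I : Set ℓ} (_≟_ : DecidableEquality I) (𝔐 : I → PointLineSpace ℓ)
         (ℋ : Pred (∀ i → Point (𝔐 i)) ℓ) where

  open Coordinates _≟_ (λ i → Point (𝔐 i))

  private
    S : Set ℓ
    S = ∀ i → Point (𝔐 i)

    [/]ˢ-line : ∀ a i {l} → l ∈ Line (𝔐 i) → a [ i / l ]ˢ ∈ Line (⨂ _≟_ 𝔐)
    [/]ˢ-line a i {l} l∈ = a , i , l , l∈ , id , id

  -- Lift the line to `a [ i / l ]ˢ`; injectivity of the replacement keeps its two chosen points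
  -- distinct.
  section-isSubspace : IsSubspace (⨂ _≟_ 𝔐) ℋ → ∀ a i → IsSubspace (𝔐 i) (section ℋ a i)
  section-isSubspace sub a i l∈ (x , y , x≢y , (x∈l , x∈ℋ) , (y∈l , y∈ℋ)) {z} z∈l =
    sub ([/]ˢ-line a i l∈)
      ( a [ i / x ] , a [ i / y ]
      , (λ eq → x≢y ([/]-injective _≟_ _ a i eq))
      , ((x , x∈l , refl) , x∈ℋ)
      , ((y , y∈l , refl) , y∈ℋ))
      (z , z∈l , refl)

  section-meetsEveryLine : (∀ {L} → L ∈ Line (⨂ _≟_ 𝔐) → L ≬ ℋ) →
                           ∀ a i {l} → l ∈ Line (𝔐 i) → l ≬ section ℋ a i
  section-meetsEveryLine meets a i l∈
    with _ , (x , x∈l , refl) , x∈ℋ ← meets ([/]ˢ-line a i l∈) = x , x∈l , x∈ℋ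

  -- All points of a product line share the base point `a` and the direction `i`, so a single
  -- section governs the whole line.
  sections-isSubspace⇒isSubspace : (∀ a i → IsSubspace (𝔐 i) (section ℋ a i)) →
                                   IsSubspace (⨂ _≟_ 𝔐) ℋ
  sections-isSubspace⇒isSubspace sub (a , i , _ , l∈ , L⊆ , _)
    (_ , _ , b≢c , (b∈L , b∈ℋ) , (c∈L , c∈ℋ)) d∈L
    with x , x∈l , refl ← L⊆ b∈L
       | y , y∈l , refl ← L⊆ c∈L
       | z , z∈l , refl ← L⊆ d∈L
    = sub a i l∈
        (x , y , (λ x≡y → b≢c (cong (a [ i /_]) x≡y)) , (x∈l , b∈ℋ) , (y∈l , c∈ℋ))
        z∈l

  sections-meet⇒meetsEveryLine : (∀ a i {l} → l ∈ Line (𝔐 i) → l ≬ section ℋ a i) →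
                                 ∀ {L} → L ∈ Line (⨂ _≟_ 𝔐) → L ≬ ℋ
  sections-meet⇒meetsEveryLine meets (a , i , _ , l∈ , _ , ⊆L)
    with x , x∈l , x∈ℋ ← meets a i l∈ = a [ i / x ] , ⊆L (x , x∈l , refl) , x∈ℋ

  module _ (em : ExcludedMiddle ℓ) where

    section-∈ℋᵃˡˡ : IsHyperplane (⨂ _≟_ 𝔐) ℋ → ∀ a i → section ℋ a i ∈ ℋᵃˡˡ (𝔐 i)
    section-∈ℋᵃˡˡ hyp a i with em {section ℋ a i ≐ U}
    ... | yes full = inj₂ full
    ... | no ¬full = inj₁ record
      { isSubspace     = section-isSubspace isSubspace a i
      ; proper         = ¬full
      ; meetsEveryLine = section-meetsEveryLine meetsEveryLine a i
      }
      where open IsHyperplane hyp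

    proper⇒properSection : Extensionality ℓ ℓ → I → ¬ (ℋ ≐ U) →
                           ∃₂ λ (a : S) i → ¬ (section ℋ a i ≐ U)
    proper⇒properSection ext i ℋ≢U = decidable-stable em λ ∄ →
      ℋ≢U ((λ _ → tt) , λ {b} _ →
        subst ℋ (ext ([/]-id _≟_ _ b i))
          -- If no section is non-full, then `b i` cannot be missing from the section through `b`,
          -- as its absence would make that section the forbidden witness.
          (decidable-stable em λ ∉ℋ → ∄ (b , i , λ (_ , U⊆) → ∉ℋ (U⊆ tt))))

theorem3p1 :
    {ℓ : Level} → ExcludedMiddle ℓ → Extensionality ℓ ℓ →
    {I : Set ℓ} (countable : Countable I) → ∃₂ (λ (i j : I) → i ≢ j) →
    (𝔐 : I → PartialLinearSpace ℓ) →
    let 𝔐ᵢ = λ i → space (𝔐 i)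
        S = ∀ i → Point (𝔐ᵢ i)
        open Coordinates (countable⇒≟ countable) (λ i → Point (𝔐ᵢ i))
    in
    (ℋ : Pred S ℓ) →
    IsHyperplane (⨂ (countable⇒≟ countable) 𝔐ᵢ) ℋ
      ⇔
    ((∀ (a : S) i → section ℋ a i ∈ ℋᵃˡˡ (𝔐ᵢ i))
      × ∃₂ (λ (a : S) i → ¬ (section ℋ a i ≐ U)))
theorem3p1 em ext countable (i₀ , _) 𝔐 ℋ = mk⇔
  (λ hyp → section-∈ℋᵃˡˡ _≟_ 𝔐ᵢ ℋ em hyp
         , proper⇒properSection _≟_ 𝔐ᵢ ℋ em ext i₀ (IsHyperplane.proper hyp))
  (λ (all , _ , _ , ¬full) → record
    { isSubspace     = sections-isSubspace⇒isSubspace _≟_ 𝔐ᵢ ℋ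
                         (λ a i → ℋᵃˡˡ⇒isSubspace (all a i))
    -- If `ℋ` were everything, so would be each of its sections, including the given non-full one.
    ; proper         = λ (_ , U⊆ℋ) → ¬full ((λ _ → tt) , λ _ → U⊆ℋ tt)
    ; meetsEveryLine = sections-meet⇒meetsEveryLine _≟_ 𝔐ᵢ ℋ
                         (λ a i → ℋᵃˡˡ⇒meetsEveryLine (isPartialLinear (𝔐 i)) (all a i))
    })
  where
  _≟_ = countable⇒≟ countable
  𝔐ᵢ  = λ i → space (𝔐 i)
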